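{- A class $\mathcal C$ of symmetric $0,1$-matrices has bounded stretch-width (i.e., there is a constant bounding $\mathrm{stw}(M)$ for all $M\in\mathcal C$) if and only if there is an integer $k$ such that no matrix of $\mathcal C$ has a $k$-wide division.
   Context: Let $M$ be a symmetric $n\times n$ $0,1$-matrix with rows $r_1,\dots,r_n$ and columns $c_1,\dots,c_n$. A symmetric partition of $M$ is a pair $(\mathcal R,\mathcal C)$ with $\mathcal R$ a partition of the rows and $\mathcal C$ a partition of the columns such that $r_i,r_j$ lie in the same part iff $c_i,c_j$ lie in the same part; each row part $R$ then has a symmetric column part (the columns with the same indices), and vice versa. For a row part $R$ and column part $C$, the zone $R\cap C$ is the submatrix with rows $R$ and columns $C$; it is non-constant if it contains two distinct entries. A symmetric partition sequence of $M$ is a sequence $(\mathcal R_n,\mathcal C_n),\dots,(\mathcal R_1,\mathcal C_1)$ of symmetric partitions, where the first is the partition into singletons, the last has one row part and one column part, and each is obtained from the previous one by merging two row parts and the two symmetric column parts. For a set $X$ of columns (or rows), its span $\langle X\rangle$ is the set of columns (rows) with index between the minimum and maximum index in $X$; two sets conflict if their spans intersect. The stretch value of a row part $R$ of $(\mathcal R,\mathcal C)$ is the number of column parts conflicting with the union of all column parts $C$ such that $C$ is the symmetric of $R$ or $R\cap C$ is non-constant; the stretch value of a column part is defined symmetrically; the stretch value of $(\mathcal R,\mathcal C)$ is the maximum stretch value of its parts. The stretch-width $\mathrm{stw}(M)$ is the minimum over all symmetric partition sequences of $M$ of the maximum stretch value of a partition in the sequence. A (symmetric) division is a symmetric partition all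 of whose parts consist of consecutive rows (resp. columns); write it as $(R_1,\dots,R_p)$, $(C_1,\dots,C_p)$ in order, $C_i$ being symmetric to $R_i$. A row part $R_i$ is $k$-wide if for every $k$ consecutive column parts $C_j,\dots,C_{j+k-1}$ with $j\le i\le j+k-1$, the submatrix with row set $R_i$ and column set all columns outside $C_j\cup\dots\cup C_{j+k-1}$ contains at least $k$ distinct rows; $k$-wideness of column parts is defined symmetrically. A division is $k$-wide if all its row and column parts are $k$-wide.
   Formalization: In k-wideness, windows of k consecutive parts are clipped at the last part; otherwise a division with fewer than k parts would be vacuously k-wide and the equivalence would fail for the all-zero matrices. Matrices are nonempty. -}

module Defs where

open import Level using (Level)
open import Data.Nat using (ℕ; suc; _+_) renaming (_≤_ to _≤ℕ_; _<_ to _<ℕ_)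
open import Data.Fin using (Fin; toℕ; _≤_)
open import Data.Bool using (Bool)
open import Data.List using (List; length)
open import Data.List.Membership.Propositional using (_∈_)
open import Data.Product using (_×_; ∃; ∃-syntax; Σ-syntax)
open import Data.Sum using (_⊎_)
open import Relation.Nullary using (¬_)
open import Relation.Binary.PropositionalEquality using (_≡_; _≢_)

Matrix : ℕ → Set
Matrix N = Fin N → Fin N → Bool

IsSymmetric : ∀ {N} → Matrix N → Set
IsSymmetric M = ∀ i j → M i j ≡ M j i

AtMost : ∀ {m} → ℕ → (Fin m → Set) → Set
AtMost {m} s P = ∃[ xs ] (length xs ≤ℕ s × (∀ (x : Fin m) → P x → x ∈ xs))

-- Symmetric partitions.  A symmetric partition with m parts of an
-- N×N matrix is given by a labelling lab : Fin N → Fin m; row part a is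
-- the set of rows with label a, column part a (its symmetric) the set of
-- columns with label a.

NonConstantZone : ∀ {N m} → Matrix N → (Fin N → Fin m) → Fin m → Fin m → Set
NonConstantZone M lab a b =
  ∃[ i ] ∃[ i' ] ∃[ j ] ∃[ j' ]
    (lab i ≡ a × lab i' ≡ a × lab j ≡ b × lab j' ≡ b × M i j ≢ M i' j')

InSpan : ∀ {N} → (Fin N → Set) → Fin N → Set
InSpan X x = ∃[ y ] ∃[ z ] (X y × X z × y ≤ x × x ≤ z)

Conflict : ∀ {N} → (Fin N → Set) → (Fin N → Set) → Set
Conflict X Y = ∃[ x ] (InSpan X x × InSpan Y x)

RowUnion : ∀ {N m} → Matrix N → (Fin N → Fin m) → Fin m → Fin N → Set
RowUnion M lab a c = lab c ≡ a ⊎ NonConstantZone M lab a (lab c)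

ColUnion : ∀ {N m} → Matrix N → (Fin N → Fin m) → Fin m → Fin N → Set
ColUnion M lab b r = lab r ≡ b ⊎ NonConstantZone M lab (lab r) b

RowStretchAtMost : ∀ {N m} → ℕ → Matrix N → (Fin N → Fin m) → Fin m → Set
RowStretchAtMost s M lab a =
  AtMost s (λ b → Conflict (λ c → lab c ≡ b) (RowUnion M lab a))

ColStretchAtMost : ∀ {N m} → ℕ → Matrix N → (Fin N → Fin m) → Fin m → Set
ColStretchAtMost s M lab b =
  AtMost s (λ a → Conflict (λ r → lab r ≡ a) (ColUnion M lab b))

StretchAtMost : ∀ {N m} → ℕ → Matrix N → (Fin N → Fin m) → Set
StretchAtMost s M lab =
  ∀ a → RowStretchAtMost s M lab a × ColStretchAtMost s M lab a

MergeOf : ∀ {N m} → (Fin N → Fin (suc m)) → (Fin N → Fin m) → Set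
MergeOf {N} {m} old new =
  ∃[ a ] ∃[ b ] (a ≢ b × (∀ (i j : Fin N) →
     (new i ≡ new j →
        old i ≡ old j ⊎ (old i ≡ a × old j ≡ b) ⊎ (old i ≡ b × old j ≡ a))
   × (old i ≡ old j ⊎ (old i ≡ a × old j ≡ b) ⊎ (old i ≡ b × old j ≡ a) →
        new i ≡ new j)))

-- A symmetric partition sequence of a (suc n)×(suc n) matrix:
-- partition number m (0 ≤ m ≤ n) has suc m parts, partition n is into
-- singletons, partition 0 has one part, and partition m is obtained
-- from partition (suc m) by merging two parts.
record SymPartitionSequence (n : ℕ) : Set where
  field
    lab        : (m : ℕ) → Fin (suc n) → Fin (suc m)
    surjective : ∀ m → m ≤ℕ n → ∀ (a : Fin (suc m)) → ∃[ i ] (lab m i ≡ a)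
    singletons : ∀ i j → lab n i ≡ lab n j → i ≡ j
    merges     : ∀ m → m <ℕ n → MergeOf (lab (suc m)) (lab m)

StwAtMost : ∀ {n} → ℕ → Matrix (suc n) → Set
StwAtMost {n} s M =
  Σ[ S ∈ SymPartitionSequence n ]
    (∀ m → m ≤ℕ n → StretchAtMost s M (SymPartitionSequence.lab S m))

-- Divisions: symmetric partitions into p parts of consecutive indices,
-- given by a monotone surjective labelling (parts in order 0,…,p-1).

IsDivision : ∀ {N p} → (Fin N → Fin p) → Set
IsDivision lab = (∀ i j → i ≤ j → lab i ≤ lab j) × (∀ a → ∃[ i ] (lab i ≡ a))

OutsideWindow : ∀ {N p} → (Fin N → Fin p) → ℕ → ℕ → Fin N → Set
OutsideWindow lab k j c = ¬ (j ≤ℕ toℕ (lab c) × toℕ (lab c) <ℕ j + k)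

RowKWide : ∀ {N p} → ℕ → Matrix N → (Fin N → Fin p) → Fin p → Set
RowKWide {N} k M lab i =
  ∀ (j : ℕ) → j ≤ℕ toℕ i → toℕ i <ℕ j + k →
    Σ[ f ∈ (Fin k → Fin N) ] ((∀ (t : Fin k) → lab (f t) ≡ i) ×
            (∀ (t t' : Fin k) → t ≢ t' →
               ∃[ c ] (OutsideWindow lab k j c × M (f t) c ≢ M (f t') c)))

ColKWide : ∀ {N p} → ℕ → Matrix N → (Fin N → Fin p) → Fin p → Set
ColKWide {N} k M lab i =
  ∀ (j : ℕ) → j ≤ℕ toℕ i → toℕ i <ℕ j + k →
    Σ[ f ∈ (Fin k → Fin N) ] ((∀ (t : Fin k) → lab (f t) ≡ i) ×
            (∀ (t t' : Fin k) → t ≢ t' →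
               ∃[ r ] (OutsideWindow lab k j r × M r (f t) ≢ M r (f t'))))

HasKWideDivision : ∀ {N} → ℕ → Matrix N → Set
HasKWideDivision {N} k M =
  ∃[ p ] Σ[ lab ∈ (Fin N → Fin p) ]
    (IsDivision lab × (∀ i → RowKWide k M lab i × ColKWide k M lab i))

{-# OPTIONS --safe #-}
module Submission where

-- Bounded stretch excludes wide divisions: if every part of a k-wide division
-- meets more than s parts of a partition of stretch value at most s, then no
-- span contains a whole part of the division, so rows with the same label
-- agree outside three consecutive parts and wideness yields k rows with
-- distinct labels in every part.  A merge costs each part of the division at
-- most one of these labels, so this persists from the singletons down to the
-- partition with one part, which is absurd.
--
-- Conversely, start from the finest division and repeatedly merge two
-- consecutive parts, keeping every part thin: it has few distinct rows once a
-- ball of 2k + 2 parts on each side of it is erased.  Pairing up consecutive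
-- parts gives a division that is not k-wide, so some pair is thin and can be
-- merged.  Call rows of one part twins if they agree outside the ball.  The
-- ball is centred at the part and has constant radius, hence it only grows
-- under merges, and the twin partition of a division refines that of the next
-- one.  Interpolating between consecutive twin partitions by single merges
-- gives a partition sequence; by symmetry of the matrix, its non-constant
-- zones lie within distance 2k + 2 of the diagonal.

open import Defs
open import Level using (Level)
open import Data.Nat using (ℕ; zero; suc; pred; _+_; _*_; _∸_; _⊓_; ⌊_/2⌋; z≤n; s≤s; s≤s⁻¹; _≤?_)
  renaming (_≤_ to _≤ℕ_; _<_ to _<ℕ_)
import Data.Nat as ℕ
import Data.Nat.Properties as ℕₚ
open import Data.Nat.Tactic.RingSolver using (solve-∀)
open import Data.Fin using (Fin; zero; suc; toℕ; fromℕ<; _≤_; _<_; punchIn; punchOut)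
import Data.Fin.Properties as Finₚ
import Data.Bool.Properties as Boolₚ
open import Data.Product using (∃-syntax; Σ-syntax; _×_; _,_; proj₁; proj₂)
open import Data.Sum using (_⊎_; inj₁; inj₂)
open import Data.List using ([]; _∷_; _++_; length; map; tabulate)
import Data.List.Properties as Listₚ
open import Data.List.Relation.Unary.Any as Any using (Any; here; index)
import Data.List.Relation.Unary.Any.Properties as Anyₚ
open import Data.List.Membership.Setoid.Properties using (index-injective)
open import Function using (_∘_; Injective)
open import Function.Bundles using (_⇔_; mk⇔)
open import Relation.Binary.Definitions using (tri<; tri≈; tri>)
open import Relation.Binary.PropositionalEquality
open import Relation.Nullary using (¬_; yes; no; contradiction; Dec)
open import Relation.Nullary.Decidable using (decidable-stable; _×-dec_; _→-dec_; ¬?)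

-- Bounded stretch excludes wide divisions

Inj : {A B : Set} → (A → B) → Set
Inj = Injective _≡_ _≡_

-- Pigeonhole: distinct elements occupy distinct positions in the covering list.
AtMost-bound : ∀ {m s t} {P : Fin m → Set} (g : Fin t → Fin m) →
  Inj g → (∀ i → P (g i)) → AtMost s P → t ≤ℕ s
AtMost-bound {t = t} g g-inj Pg (xs , ∣xs∣≤s , P⊆xs) =
  ℕₚ.≤-trans (Finₚ.injective⇒≤ {f = λ i → index (mem i)}
    (λ {i} {j} eq → g-inj (index-injective (setoid _) (mem i) (mem j) eq))) ∣xs∣≤s
  where mem = λ i → P⊆xs (g i) (Pg i)

≤1+pred : ∀ n → n ≤ℕ suc (pred n)
≤1+pred zero    = z≤n
≤1+pred (suc n) = ℕₚ.≤-refl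

-- With `n = pred j`, the slack 2 covers part `j + 1`; this is where the summand 3 in `3 + s` comes
-- from.
in-window : ∀ {v n} s → v ≤ℕ 2 + n → v <ℕ n + (3 + s)
in-window {v} {n} s v≤2+n = begin-strict
  v           <⟨ s≤s v≤2+n ⟩
  3 + n       ≤⟨ ℕₚ.m≤n+m (3 + n) s ⟩
  s + (3 + n) ≡⟨ ℕₚ.+-comm s (3 + n) ⟩
  3 + n + s   ≡⟨ cong (_+ s) (ℕₚ.+-comm 3 n) ⟩
  n + 3 + s   ≡⟨ ℕₚ.+-assoc n 3 s ⟩
  n + (3 + s) ∎
  where open ℕₚ.≤-Reasoning

Meets : ∀ {N m p} → ℕ → (Fin N → Fin m) → (Fin N → Fin p) → Fin p → Set
Meets {N} t lab δ j =
  Σ[ g ∈ (Fin t → Fin N) ] ((∀ x → δ (g x) ≡ j) × Inj (lab ∘ g))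

-- At most one chosen element has label `a`; once it is dropped, identifying `a` with `b` keeps the
-- remaining labels distinct.
meets-merge : ∀ {N m p t} {old : Fin N → Fin (suc m)} {new : Fin N → Fin m}
  {δ : Fin N → Fin p} {j} → MergeOf old new → Meets (suc t) old δ j → Meets t new δ j
meets-merge {N} {t = t} {old} {new} {δ} {j} (a , b , _ , mrg) (g , δg , g-inj) =
  drop (Finₚ.any? (λ x → old (g x) Finₚ.≟ a))
  where
  skip : (x₀ : Fin (suc t)) → (∀ x → x ≢ x₀ → old (g x) ≢ a) → Meets t new δ j
  skip x₀ ≢a = g ∘ punchIn x₀ , δg ∘ punchIn x₀ , inj
    where
    avoids : ∀ x → old (g (punchIn x₀ x)) ≢ a
    avoids x = ≢a _ (Finₚ.punchInᵢ≢i x₀ x)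
    inj : Inj (new ∘ g ∘ punchIn x₀)
    inj {x} {y} eq with proj₁ (mrg _ _) eq
    ... | inj₁ same = Finₚ.punchIn-injective x₀ _ _ (g-inj same)
    ... | inj₂ (inj₁ (x∈a , _)) = contradiction x∈a (avoids x)
    ... | inj₂ (inj₂ (_ , y∈a)) = contradiction y∈a (avoids y)
  drop : _ → Meets t new δ j
  drop (yes (x₀ , x₀∈a)) = skip x₀ λ x x≢ x∈a → x≢ (g-inj (trans x∈a (sym x₀∈a)))
  -- No chosen element has label `a`, so any one may be dropped.
  drop (no none) = skip zero λ x _ x∈a → none (x , x∈a)

module _ {N p : ℕ} {δ : Fin N → Fin p} (mono : ∀ i j → i ≤ j → δ i ≤ δ j) where

  δ<⇒≤ : ∀ {x y} → δ x < δ y → x ≤ y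
  δ<⇒≤ {x} {y} δx<δy = ℕₚ.≮⇒≥ λ y<x → ℕₚ.<⇒≱ δx<δy (mono y x (ℕₚ.<⇒≤ y<x))

  module _ {m s : ℕ} (M : Matrix N) (lab : Fin N → Fin m)
    (rows : ∀ a → RowStretchAtMost s M lab a)
    (meets : ∀ j → Meets (suc s) lab δ j) where

    -- Such a span would contain all of part `j`, hence conflict with each of the `s + 1` labels
    -- found there.
    no-part-inside : ∀ {a} j {y z} → RowUnion M lab a y → RowUnion M lab a z →
      δ y < j → ¬ j < δ z
    no-part-inside {a} j {y} {z} y∈ z∈ y<j j<z with meets j
    ... | g , δg , g-inj = ℕₚ.1+n≰n (AtMost-bound (lab ∘ g) g-inj conflicts (rows a))
      where
      conflicts : ∀ x → Conflict (λ c → lab c ≡ lab (g x)) (RowUnion M lab a)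
      conflicts x = g x
        , (g x , g x , refl , refl , Finₚ.≤-refl , Finₚ.≤-refl)
        , (y , z , y∈ , z∈
          , δ<⇒≤ (subst (δ y <_) (sym (δg x)) y<j)
          , δ<⇒≤ (subst (_< δ z) (sym (δg x)) j<z))

    -- Otherwise the part right after that of `y` would lie strictly inside the span.
    adjacent : ∀ {a y z} → RowUnion M lab a y → RowUnion M lab a z →
      toℕ (δ z) ≤ℕ suc (toℕ (δ y))
    adjacent {y = y} {z} y∈ z∈ = ℕₚ.≮⇒≥ λ gap →
      let j<p = ℕₚ.<-trans gap (Finₚ.toℕ<n (δ z))
          toℕ-j = Finₚ.toℕ-fromℕ< j<p
      in no-part-inside (fromℕ< j<p) y∈ z∈
           (subst (toℕ (δ y) <ℕ_) (sym toℕ-j) ℕₚ.≤-refl)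
           (subst (_<ℕ toℕ (δ z)) (sym toℕ-j) gap)

    -- Rows with the same label differ only inside a span, hence only within
    -- three consecutive parts of δ.
    wide⇒meets : ∀ {j} → RowKWide (3 + s) M δ j → Meets (3 + s) lab δ j
    wide⇒meets {j} wide
      with wide (pred (toℕ j)) ℕₚ.pred[n]≤n (in-window s (ℕₚ.m≤n⇒m≤1+n (≤1+pred (toℕ j))))
    ... | f , δf , distinct = f , δf , λ {x} {y} eq →
      decidable-stable (x Finₚ.≟ y) λ x≢y →
        let c , c∉window , Mxc≢Myc = distinct x y x≢y
            c∈ : RowUnion M lab (lab (f x)) c
            c∈ = inj₂ (f x , f y , c , c , refl , sym eq , refl , refl , Mxc≢Myc)
            close : toℕ (δ c) ≤ℕ suc (toℕ j)
            close = subst (λ i → toℕ (δ c) ≤ℕ suc (toℕ i)) (δf x) (adjacent (inj₁ refl) c∈)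
            close′ : toℕ j ≤ℕ suc (toℕ (δ c))
            close′ = subst (λ i → toℕ i ≤ℕ suc (toℕ (δ c))) (δf x) (adjacent c∈ (inj₁ refl))
        in c∉window ( ℕₚ.pred-mono-≤ close′
                    , in-window s (ℕₚ.≤-trans close (s≤s (≤1+pred (toℕ j)))))


no-wide-division : ∀ {n s} (M : Matrix (suc n)) → StwAtMost s M → ¬ HasKWideDivision (3 + s) M
no-wide-division {n} {s} M (S , stretch) (p , δ , (mono , _) , wide) =
  -- At level 0, part `δ zero` would carry `3 + s` distinct labels although there is only one.
  ℕₚ.1+n≰n (ℕₚ.≤-trans (s≤s (s≤s z≤n))
    (Finₚ.injective⇒≤ (proj₂ (proj₂ (meets 0 n (ℕₚ.+-identityʳ n) (δ zero))))))
  where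
  open SymPartitionSequence S
  initially : ∀ j → Meets (3 + s) (lab n) δ j
  initially j with proj₁ (wide j) (toℕ j) ℕₚ.≤-refl (ℕₚ.m<m+n (toℕ j) (s≤s z≤n))
  ... | f , δf , distinct = f , δf , λ {x} {y} eq →
    decidable-stable (x Finₚ.≟ y) λ x≢y →
      let c , _ , Mxc≢Myc = distinct x y x≢y
      in Mxc≢Myc (cong (λ r → M r c) (singletons _ _ eq))
  meets : ∀ m d → d + m ≡ n → ∀ j → Meets (3 + s) (lab m) δ j
  meets m zero refl = initially
  meets m (suc d) eq j =
    -- A merge leaves `2 + s` of the `3 + s` labels; `1 + s` already exceed the stretch bound, and
    -- wideness then restores `3 + s`.
    wide⇒meets mono M (lab m) (λ a → proj₁ (stretch m (ℕₚ.<⇒≤ m<n) a))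
      (λ i → shrink (meets-merge {δ = δ} (merges m m<n) (meets (suc m) d (trans (ℕₚ.+-suc d m) eq) i)))
      (proj₁ (wide j))
    where
    m<n : m <ℕ n
    m<n = ℕₚ.≤-trans (s≤s (ℕₚ.m≤n+m m d)) (ℕₚ.≤-reflexive eq)
    shrink : ∀ {i} → Meets (2 + s) (lab m) δ i → Meets (1 + s) (lab m) δ i
    shrink (g , δg , g-inj) = g ∘ suc , δg ∘ suc , λ eq′ → Finₚ.suc-injective (g-inj eq′)

-- Greedy choice of distinct rows

-- Extend a family of pairwise unrelated elements as long as possible; when no element of `P` can be
-- added, the family itself covers `P`.
representatives : ∀ {N} {P : Fin N → Set} {_~_ : Fin N → Fin N → Set} →
  (∀ i → Dec (P i)) → (∀ i j → Dec (i ~ j)) → (∀ {i j} → i ~ j → j ~ i) → ∀ k →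
  (Σ[ f ∈ (Fin k → Fin N) ] ((∀ t → P (f t)) × (∀ t u → t ≢ u → ¬ f t ~ f u)))
  ⊎ (∃[ xs ] (length xs ≤ℕ k × (∀ i → P i → Any (λ x → P x × i ~ x) xs)))
representatives P? ~? ~sym zero = inj₁ ((λ ()) , (λ ()) , λ ())
representatives {N} {P} {_~_} P? ~? ~sym (suc k) with representatives P? ~? ~sym k
... | inj₂ (xs , len , cover) = inj₂ (xs , ℕₚ.m≤n⇒m≤1+n len , cover)
... | inj₁ (f , Pf , f-distinct)
  with Finₚ.any? (λ i → P? i ×-dec Finₚ.all? (λ t → ¬? (~? i (f t))))
... | yes (x , Px , x≁f) = inj₁ (g , Pg , g-distinct)
  where
  g : Fin (suc k) → Fin N
  g zero    = x
  g (suc t) = f t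
  Pg : ∀ t → P (g t)
  Pg zero    = Px
  Pg (suc t) = Pf t
  g-distinct : ∀ t u → t ≢ u → ¬ g t ~ g u
  g-distinct zero    zero    t≢u = contradiction refl t≢u
  g-distinct zero    (suc u) _   = x≁f u
  g-distinct (suc t) zero    _   = x≁f t ∘ ~sym
  g-distinct (suc t) (suc u) t≢u = f-distinct t u (t≢u ∘ cong suc)
... | no saturated = inj₂
  ( tabulate f
  , ℕₚ.≤-trans (ℕₚ.≤-reflexive (Listₚ.length-tabulate f)) (ℕₚ.n≤1+n k)
  , λ i Pi → cover i (decidable-stable (Finₚ.any? λ t → ~? i (f t))
      λ none → saturated (i , Pi , λ t i~ft → none (t , i~ft))))
  where
  cover : ∀ i → ∃[ t ] (i ~ f t) → Any (λ x → P x × i ~ x) (tabulate f)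
  cover i (t , i~ft) = Anyₚ.tabulate⁺ t (Pf t , i~ft)

-- Merging two consecutive parts of a division

contract : ℕ → ℕ → ℕ
contract zero    l       = pred l
contract (suc y) zero    = zero
contract (suc y) (suc l) = suc (contract y l)

contract≤ : ∀ y l → contract y l ≤ℕ l
contract≤ zero    l       = ℕₚ.pred[n]≤n
contract≤ (suc y) zero    = z≤n
contract≤ (suc y) (suc l) = s≤s (contract≤ y l)

-- Merging consecutive parts never increases the distance between parts, so a ball of fixed radius
-- only gains columns.
contract-nonexpansive : ∀ y {u v} w → u ≤ℕ v + w → contract y u ≤ℕ contract y v + w
contract-nonexpansive zero {u} {zero}  w u≤w = ℕₚ.≤-trans ℕₚ.pred[n]≤n u≤w
contract-nonexpansive zero {u} {suc v} w u≤v+w = ℕₚ.pred-mono-≤ u≤v+w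
contract-nonexpansive (suc y) {zero}  {v}     w _     = z≤n
contract-nonexpansive (suc y) {suc u} {zero}  w u≤w   = ℕₚ.≤-trans (s≤s (contract≤ y u)) u≤w
contract-nonexpansive (suc y) {suc u} {suc v} w u≤v+w =
  s≤s (contract-nonexpansive y w (s≤s⁻¹ u≤v+w))

contract-mono : ∀ y {u v} → u ≤ℕ v → contract y u ≤ℕ contract y v
contract-mono y {u} {v} u≤v = subst (contract y u ≤ℕ_) (ℕₚ.+-identityʳ _)
  (contract-nonexpansive y 0 (subst (u ≤ℕ_) (sym (ℕₚ.+-identityʳ v)) u≤v))

contract-below : ∀ {y l} → l ≤ℕ y → contract y l ≡ l
contract-below {zero}  z≤n       = refl
contract-below {suc y} z≤n       = refl
contract-below {suc y} (s≤s l≤y) = cong suc (contract-below l≤y)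

contract-above : ∀ {y l} → y ≤ℕ l → contract y (suc l) ≡ l
contract-above z≤n       = refl
contract-above (s≤s y≤l) = cong suc (contract-above y≤l)

-- Part `l` of the merged division is thus covered by the old parts `l` and `l + 1`.
contract-fibre : ∀ y l → l ≡ contract y l × l ≤ℕ y ⊎ l ≡ suc (contract y l) × y ≤ℕ contract y l
contract-fibre zero    zero    = inj₁ (refl , z≤n)
contract-fibre zero    (suc l) = inj₂ (refl , z≤n)
contract-fibre (suc y) zero    = inj₁ (refl , z≤n)
contract-fibre (suc y) (suc l) with contract-fibre y l
... | inj₁ (eq , l≤y) = inj₁ (cong suc eq , s≤s l≤y)
... | inj₂ (eq , y≤l) = inj₂ (cong suc eq , s≤s y≤l)

-- An index above 2q + 1 joins the last pair q: with an odd number of parts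
-- the last class of the pairing is a triple.

pair : ℕ → ℕ → ℕ
pair q l = ⌊ l /2⌋ ⊓ q

pair-mono : ∀ q {u v} → u ≤ℕ v → pair q u ≤ℕ pair q v
pair-mono q u≤v = ℕₚ.⊓-monoˡ-≤ q (ℕₚ.⌊n/2⌋-mono u≤v)

pair-even : ∀ {q x} → x ≤ℕ q → pair q (x + x) ≡ x
pair-even {q} {x} x≤q rewrite sym (ℕₚ.n≡⌊n+n/2⌋ x) = ℕₚ.m≤n⇒m⊓n≡m x≤q

n≡⌊1+n+n/2⌋ : ∀ n → n ≡ ⌊ suc (n + n) /2⌋
n≡⌊1+n+n/2⌋ zero = refl
n≡⌊1+n+n/2⌋ (suc n) rewrite ℕₚ.+-suc n n = cong suc (n≡⌊1+n+n/2⌋ n)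

pair-odd : ∀ {q x} → x ≤ℕ q → pair q (suc (x + x)) ≡ x
pair-odd {q} {x} x≤q rewrite sym (n≡⌊1+n+n/2⌋ x) = ℕₚ.m≤n⇒m⊓n≡m x≤q

⌊n/2⌋+⌊n/2⌋≤n : ∀ n → ⌊ n /2⌋ + ⌊ n /2⌋ ≤ℕ n
⌊n/2⌋+⌊n/2⌋≤n zero = z≤n
⌊n/2⌋+⌊n/2⌋≤n (suc zero) = z≤n
⌊n/2⌋+⌊n/2⌋≤n (suc (suc n)) rewrite ℕₚ.+-suc ⌊ n /2⌋ ⌊ n /2⌋ = s≤s (s≤s (⌊n/2⌋+⌊n/2⌋≤n n))

n≤1+⌊n/2⌋+⌊n/2⌋ : ∀ n → n ≤ℕ 1 + (⌊ n /2⌋ + ⌊ n /2⌋)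
n≤1+⌊n/2⌋+⌊n/2⌋ zero = z≤n
n≤1+⌊n/2⌋+⌊n/2⌋ (suc zero) = s≤s z≤n
n≤1+⌊n/2⌋+⌊n/2⌋ (suc (suc n)) rewrite ℕₚ.+-suc ⌊ n /2⌋ ⌊ n /2⌋ = s≤s (s≤s (n≤1+⌊n/2⌋+⌊n/2⌋ n))

double-pair≤ : ∀ q l → pair q l + pair q l ≤ℕ l
double-pair≤ q l =
  ℕₚ.≤-trans (ℕₚ.+-mono-≤ pair≤half pair≤half) (⌊n/2⌋+⌊n/2⌋≤n l)
  where pair≤half = ℕₚ.m⊓n≤m ⌊ l /2⌋ q

≤double-pair : ∀ q l → l ≤ℕ 2 + (q + q) → l ≤ℕ 2 + (pair q l + pair q l)
≤double-pair q l l≤ with ℕₚ.⊓-sel ⌊ l /2⌋ q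
... | inj₁ eq rewrite eq = ℕₚ.m≤n⇒m≤1+n (n≤1+⌊n/2⌋+⌊n/2⌋ l)
... | inj₂ eq rewrite eq = l≤

-- Origin of the radius `2k + 2`: class `x` of the pairing lies between the parts `2x` and `2x + 2`,
-- so `k` steps between classes amount to at most `2k + 2` steps between parts.
pair-nonexpansive : ∀ q {u v} k → u ≤ℕ 2 + (q + q) → pair q u ≤ℕ pair q v + k →
  u ≤ℕ v + (suc k + suc k)
pair-nonexpansive q {u} {v} k u≤ close = begin
  u                                     ≤⟨ ≤double-pair q u u≤ ⟩
  2 + (pair q u + pair q u)             ≤⟨ ℕₚ.+-monoʳ-≤ 2 (ℕₚ.+-mono-≤ close close) ⟩
  2 + ((pair q v + k) + (pair q v + k)) ≡⟨ rearrange (pair q v) k ⟩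
  (pair q v + pair q v) + (suc k + suc k) ≤⟨ ℕₚ.+-monoˡ-≤ _ (double-pair≤ q v) ⟩
  v + (suc k + suc k)                   ∎
  where
  open ℕₚ.≤-Reasoning
  rearrange : ∀ a k → 2 + ((a + k) + (a + k)) ≡ (a + a) + (suc k + suc k)
  rearrange = solve-∀

-- Balls in a division and twin rows

Near : ℕ → ℕ → ℕ → Set
Near w u v = u ≤ℕ v + w × v ≤ℕ u + w

near? : ∀ w u v → Dec (Near w u v)
near? w u v = (u ≤? v + w) ×-dec (v ≤? u + w)

contract-near : ∀ y {w u v} → Near w u v → Near w (contract y u) (contract y v)
contract-near y {w} (p , q) = contract-nonexpansive y w p , contract-nonexpansive y w q

Agree : ∀ {N} → ℕ → Matrix N → (Fin N → ℕ) → ℕ → Fin N → Fin N → Set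
Agree w M δ u i j = ∀ c → ¬ Near w u (δ c) → M i c ≡ M j c

agree? : ∀ {N} w (M : Matrix N) δ u i j → Dec (Agree w M δ u i j)
agree? w M δ u i j = Finₚ.all? λ c → ¬? (near? w u (δ c)) →-dec (M i c Boolₚ.≟ M j c)

¬agree⇒differ : ∀ {N w} (M : Matrix N) {δ u i j} → ¬ Agree w M δ u i j →
  ∃[ c ] (¬ Near w u (δ c) × M i c ≢ M j c)
¬agree⇒differ {N} {w} M {δ} {u} {i} {j} ¬agree
  with c , ¬imp ← Finₚ.¬∀⟶∃¬ N _
         (λ c → ¬? (near? w u (δ c)) →-dec (M i c Boolₚ.≟ M j c)) ¬agree
  = c , (λ near → ¬imp (contradiction near)) , λ eq → ¬imp (λ _ → eq)

Twins : ∀ {N} → ℕ → Matrix N → (Fin N → ℕ) → Fin N → Fin N → Set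
Twins w M δ i j = δ i ≡ δ j × Agree w M δ (δ i) i j

twins? : ∀ {N} w (M : Matrix N) δ i j → Dec (Twins w M δ i j)
twins? w M δ i j = (δ i ℕ.≟ δ j) ×-dec agree? w M δ (δ i) i j

module _ {N w : ℕ} {M : Matrix N} {δ : Fin N → ℕ} where

  twins-sym : ∀ {i j} → Twins w M δ i j → Twins w M δ j i
  twins-sym (δi≡δj , agree) = sym δi≡δj , λ c far →
    sym (agree c (subst (λ u → ¬ Near w u (δ c)) (sym δi≡δj) far))

  twins-trans : ∀ {i j l} → Twins w M δ i j → Twins w M δ j l → Twins w M δ i l
  twins-trans (δi≡δj , agree) (δj≡δl , agree′) = trans δi≡δj δj≡δl , λ c far →
    trans (agree c far) (agree′ c (subst (λ u → ¬ Near w u (δ c)) δi≡δj far))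

  -- A column outside the ball after the merge was already outside it before.
  twins-contract : ∀ y {i j} → Twins w M δ i j → Twins w M (contract y ∘ δ) i j
  twins-contract y (δi≡δj , agree) =
    cong (contract y) δi≡δj , λ c far → agree c (far ∘ contract-near y)

-- Thin parts

-- Taken with `Twins` it is the invariant of the divisions; taken with `SameLabel` it bounds the
-- number of labels in each part.
Thin : ∀ {N} → ℕ → (Fin N → Fin N → Set) → (Fin N → ℕ) → Set
Thin K R δ = ∀ l → ∃[ xs ] (length xs ≤ℕ K × (∀ i → δ i ≡ l → Any (R i) xs))

SameLabel : ∀ {N m} → (Fin N → Fin m) → Fin N → Fin N → Set
SameLabel lab i j = lab i ≡ lab j

thin-⊆ : ∀ {N K} {R R′ : Fin N → Fin N → Set} {δ} →
  (∀ {i j} → R i j → R′ i j) → Thin K R δ → Thin K R′ δ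
thin-⊆ R⊆R′ thin l with xs , len , cover ← thin l =
  xs , len , λ i δi≡l → Any.map R⊆R′ (cover i δi≡l)

thin-contract : ∀ {N K} {R : Fin N → Fin N → Set} {δ} y →
  Thin K R δ → Thin (K + K) R (contract y ∘ δ)
thin-contract {K = K} {R} {δ} y thin l
  with xs , len , cover ← thin l | xs′ , len′ , cover′ ← thin (suc l) =
  xs ++ xs′ , len-++ , λ i eq → cover-++ i eq (contract-fibre y (δ i))
  where
  len-++ : length (xs ++ xs′) ≤ℕ K + K
  len-++ rewrite Listₚ.length-++ xs {xs′} = ℕₚ.+-mono-≤ len len′
  cover-++ : ∀ i → contract y (δ i) ≡ l → _ → Any (R i) (xs ++ xs′)
  cover-++ i eq (inj₁ (δi≡ , _)) = Anyₚ.++⁺ˡ (cover i (trans δi≡ eq))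
  cover-++ i eq (inj₂ (δi≡ , _)) = Anyₚ.++⁺ʳ xs (cover′ i (trans δi≡ (cong suc eq)))

thin-interval : ∀ {N K} {R : Fin N → Fin N → Set} {δ} → Thin K R δ → ∀ b t →
  ∃[ xs ] (length xs ≤ℕ t * K × (∀ i → b ≤ℕ δ i → δ i <ℕ b + t → Any (R i) xs))
thin-interval thin b zero = [] , z≤n , λ i b≤ <b →
  contradiction (subst (_ <ℕ_) (ℕₚ.+-identityʳ b) <b) (ℕₚ.≤⇒≯ b≤)
thin-interval {K = K} {R} {δ} thin b (suc t)
  with xs , len , cover ← thin (b + t) | xs′ , len′ , cover′ ← thin-interval thin b t =
  xs ++ xs′ , len-++ , cover-++
  where
  len-++ : length (xs ++ xs′) ≤ℕ K + t * K
  len-++ rewrite Listₚ.length-++ xs {xs′} = ℕₚ.+-mono-≤ len len′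
  cover-++ : ∀ i → b ≤ℕ δ i → δ i <ℕ b + suc t → Any (R i) (xs ++ xs′)
  cover-++ i b≤ δ< with δ i ℕ.≟ b + t
  ... | yes eq = Anyₚ.++⁺ˡ (cover i eq)
  ... | no neq = Anyₚ.++⁺ʳ xs (cover′ i b≤
    (ℕₚ.≤∧≢⇒< (s≤s⁻¹ (subst (δ i <ℕ_) (ℕₚ.+-suc b t) δ<)) neq))

Onto : ∀ {N m} → (Fin N → Fin m) → Set
Onto {m = m} lab = ∀ (a : Fin m) → ∃[ i ] (lab i ≡ a)

-- Stretch value of a refinement of the twin partition

module Stretch {N w K m : ℕ} {M : Matrix N} (M-sym : IsSymmetric M)
  {δ : Fin N → ℕ} (mono : ∀ i j → i ≤ j → δ i ≤ℕ δ j)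
  {lab : Fin N → Fin m} (onto : Onto lab)
  (refines : ∀ {i j} → lab i ≡ lab j → Twins w M δ i j)
  (thin : Thin K (SameLabel lab) δ) where

  -- A zone away from the diagonal is constant: replacing the row by a twin keeps the entry and, by
  -- symmetry of `M`, so does replacing the column.
  union-near : ∀ {i c} → RowUnion M lab (lab i) c → Near w (δ i) (δ c)
  union-near {i} {c} (inj₁ eq) rewrite proj₁ (refines eq) = ℕₚ.m≤m+n _ w , ℕₚ.m≤m+n _ w
  union-near {i} {c} (inj₂ (r , r′ , s , s′ , r∈ , r′∈ , s∈ , s′∈ , Mrs≢)) =
    decidable-stable (near? w (δ i) (δ c)) λ far → Mrs≢ (begin
      M r s   ≡⟨ proj₂ (refines (trans r∈ (sym r′∈))) s
                   (far ∘ subst₂ (Near w) (proj₁ (refines r∈)) (proj₁ (refines s∈))) ⟩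
      M r′ s  ≡⟨ M-sym r′ s ⟩
      M s r′  ≡⟨ proj₂ (refines (trans s∈ (sym s′∈))) r′
                   (far ∘ near-sym ∘ subst₂ (Near w) (proj₁ (refines s∈)) (proj₁ (refines r′∈))) ⟩
      M s′ r′ ≡⟨ M-sym s′ r′ ⟩
      M r′ s′ ∎)
    where
    open ≡-Reasoning
    near-sym : ∀ {u v} → Near w u v → Near w v u
    near-sym (p , q) = q , p

  row-stretch : ∀ a → RowStretchAtMost (suc (w + w) * K) M lab a
  row-stretch a with i , refl ← onto a
    -- The `2w + 1` parts from `δ i ∸ w` on include all those within distance `w` of `δ i`.
    with xs , len , cover ← thin-interval thin (δ i ∸ w) (suc (w + w))
    = map lab xs , ℕₚ.≤-trans (ℕₚ.≤-reflexive (Listₚ.length-map lab xs)) len , covers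
    where
    covers : ∀ b → Conflict (λ c → lab c ≡ b) (RowUnion M lab (lab i)) → Any (b ≡_) (map lab xs)
    covers b (x , (s , t , refl , t∈ , s≤x , x≤t) , (y , z , y∈ , z∈ , y≤x , x≤z)) =
      Anyₚ.map⁺ (cover s (proj₁ s-range) (proj₂ s-range))
      where
      -- A label stays within one part of `δ`, so the whole span from `s` to `t`, and `x` with it,
      -- lies in the part of `s`.
      δs≤δx = mono s x s≤x
      δx≤δs = ℕₚ.≤-trans (mono x t x≤t) (ℕₚ.≤-reflexive (proj₁ (refines t∈)))
      above : δ i ≤ℕ δ s + w
      above = ℕₚ.≤-trans (proj₁ (union-near y∈))
        (ℕₚ.+-monoˡ-≤ w (ℕₚ.≤-trans (mono y x y≤x) δx≤δs))
      below : δ s ≤ℕ δ i + w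
      below = ℕₚ.≤-trans (ℕₚ.≤-trans δs≤δx (mono x z x≤z)) (proj₂ (union-near z∈))
      s-range : δ i ∸ w ≤ℕ δ s × δ s <ℕ (δ i ∸ w) + suc (w + w)
      s-range = ℕₚ.m≤n+o⇒m∸n≤o (δ i) w (ℕₚ.≤-trans above (ℕₚ.≤-reflexive (ℕₚ.+-comm (δ s) w)))
        , (begin-strict
            δ s                       ≤⟨ below ⟩
            δ i + w                   ≤⟨ ℕₚ.+-monoˡ-≤ w (ℕₚ.m≤n+m∸n (δ i) w) ⟩
            w + (δ i ∸ w) + w         <⟨ ℕₚ.≤-refl ⟩
            suc (w + (δ i ∸ w) + w)   ≡⟨ rearrange w (δ i ∸ w) ⟩
            (δ i ∸ w) + suc (w + w)   ∎)
        where
        open ℕₚ.≤-Reasoning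
        rearrange : ∀ w v → suc (w + v + w) ≡ v + suc (w + w)
        rearrange = solve-∀

  col⊆row : ∀ {b r} → ColUnion M lab b r → RowUnion M lab b r
  col⊆row (inj₁ eq) = inj₁ eq
  col⊆row (inj₂ (i , i′ , j , j′ , i∈ , i′∈ , j∈ , j′∈ , M≢)) =
    inj₂ (j , j′ , i , i′ , j∈ , j′∈ , i∈ , i′∈
         , λ eq → M≢ (trans (M-sym i j) (trans eq (M-sym j′ i′))))

  stretch : StretchAtMost (suc (w + w) * K) M lab
  stretch a with xs , len , cover ← row-stretch a =
    (xs , len , cover) , (xs , len , λ b → cover b ∘
      λ (x , b-span , (y , z , y∈ , z∈ , y≤x , x≤z)) →
        x , b-span , (y , z , col⊆row y∈ , col⊆row z∈ , y≤x , x≤z))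

-- Coarsening a thin division

∀⊎∃ : ∀ {n} {P Q : Fin n → Set} → (∀ x → P x ⊎ Q x) → (∀ x → P x) ⊎ (∃[ x ] Q x)
∀⊎∃ {zero}  P⊎Q = inj₁ λ ()
∀⊎∃ {suc n} P⊎Q with P⊎Q zero | ∀⊎∃ (λ x → P⊎Q (suc x))
... | inj₂ Q₀ | _              = inj₂ (zero , Q₀)
... | inj₁ _  | inj₂ (x , Qx)  = inj₂ (suc x , Qx)
... | inj₁ P₀ | inj₁ P₊        = inj₁ λ { zero → P₀ ; (suc x) → P₊ x }

-- There are `q + 1` parts, numbered from 0 by natural numbers, so that a merge is a composition
-- with `contract`.
record ThinDivision {N} (w K : ℕ) (M : Matrix N) (q : ℕ) (δ : Fin N → ℕ) : Set where
  field
    mono    : ∀ i j → i ≤ j → δ i ≤ℕ δ j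
    bounded : ∀ i → δ i ≤ℕ q
    onto    : ∀ l → l ≤ℕ q → ∃[ i ] (δ i ≡ l)
    thin    : Thin K (Twins w M δ) δ

module Coarsen {N k q : ℕ} {M : Matrix N} (M-sym : IsSymmetric M) {δ : Fin N → ℕ}
  (D : ThinDivision (suc k + suc k) (suc k) M (suc q) δ) where

  open ThinDivision D
  open ℕₚ.≤-Reasoning

  -- With parts `0` to `q + 1`, this makes `2x` and `2x + 1` parts for every `x ≤ Q`, and at most
  -- part `2Q + 2` is left over.
  w Q : ℕ
  w = suc k + suc k
  Q = ⌊ q /2⌋

  paired : Fin N → ℕ
  paired i = pair Q (δ i)

  paired-lab : Fin N → Fin (suc Q)
  paired-lab i = fromℕ< (s≤s (ℕₚ.m⊓n≤n ⌊ δ i /2⌋ Q))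

  toℕ-paired-lab : ∀ i → toℕ (paired-lab i) ≡ paired i
  toℕ-paired-lab i = Finₚ.toℕ-fromℕ< _

  double : Fin (suc Q) → ℕ
  double x = toℕ x + toℕ x

  ≤Q : (x : Fin (suc Q)) → toℕ x ≤ℕ Q
  ≤Q x = s≤s⁻¹ (Finₚ.toℕ<n x)

  double≤q : ∀ x → double x ≤ℕ q
  double≤q x = ℕₚ.≤-trans (ℕₚ.+-mono-≤ (≤Q x) (≤Q x)) (⌊n/2⌋+⌊n/2⌋≤n q)

  δ≤ : ∀ i → δ i ≤ℕ 2 + (Q + Q)
  δ≤ i = ℕₚ.≤-trans (bounded i) (s≤s (n≤1+⌊n/2⌋+⌊n/2⌋ q))

  -- The rows of the parts 2x and 2x + 1.
  InPair : Fin (suc Q) → Fin N → Set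
  InPair x i = contract (double x) (δ i) ≡ double x

  inPair⇒paired : ∀ {x i} → InPair x i → paired i ≡ toℕ x
  inPair⇒paired {x} {i} i∈ with contract-fibre (double x) (δ i)
  ... | inj₁ (eq , _) rewrite trans eq i∈ = pair-even (≤Q x)
  ... | inj₂ (eq , _) rewrite trans eq (cong suc i∈) = pair-odd (≤Q x)

  paired-division : IsDivision paired-lab
  paired-division = lab-mono , lab-onto
    where
    lab-mono : ∀ i j → i ≤ j → paired-lab i ≤ paired-lab j
    lab-mono i j i≤j = subst₂ _≤ℕ_ (sym (toℕ-paired-lab i)) (sym (toℕ-paired-lab j))
      (pair-mono Q (mono i j i≤j))
    lab-onto : ∀ x → ∃[ i ] (paired-lab i ≡ x)
    lab-onto x with i , δi≡ ← onto (double x) (ℕₚ.m≤n⇒m≤1+n (double≤q x)) =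
      i , Finₚ.toℕ-injective
        (trans (toℕ-paired-lab i) (trans (cong (pair Q) δi≡) (pair-even (≤Q x))))

  -- Rows come from two parts only, even in a triple, so that failure gives representatives for
  -- exactly the part to be merged.
  Distinct : Fin (suc Q) → Set
  Distinct x = Σ[ f ∈ (Fin k → Fin N) ]
    ((∀ t → InPair x (f t)) × (∀ t u → t ≢ u → ¬ Agree k M paired (toℕ x) (f t) (f u)))

  -- Every window of `k` classes containing `x` lies in the ball of radius `k` around `x`, so one
  -- family of rows serves all windows; columns follow by symmetry.
  distinct⇒wide : ∀ {x} → Distinct x → RowKWide k M paired-lab x × ColKWide k M paired-lab x
  distinct⇒wide {x} (f , f∈ , differ) =
      (λ j j≤x x<j+k → f , f-lab , λ t u t≢u →
        let c , far , M≢ = ¬agree⇒differ M (differ t u t≢u) in c , outside j≤x x<j+k far , M≢)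
    , (λ j j≤x x<j+k → f , f-lab , λ t u t≢u →
        let c , far , M≢ = ¬agree⇒differ M (differ t u t≢u)
        in c , outside j≤x x<j+k far , λ eq → M≢ (trans (M-sym _ _) (trans eq (M-sym _ _))))
    where
    f-lab : ∀ t → paired-lab (f t) ≡ x
    f-lab t = Finₚ.toℕ-injective (trans (toℕ-paired-lab (f t)) (inPair⇒paired (f∈ t)))
    outside : ∀ {j c} → j ≤ℕ toℕ x → toℕ x <ℕ j + k → ¬ Near k (toℕ x) (paired c) →
      OutsideWindow paired-lab k j c
    outside {j} {c} j≤x x<j+k far (j≤c , c<j+k) =
      far (subst (Near k (toℕ x)) (toℕ-paired-lab c)
        ( ℕₚ.≤-trans (ℕₚ.<⇒≤ x<j+k) (ℕₚ.+-monoˡ-≤ k j≤c)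
        , ℕₚ.≤-trans (ℕₚ.<⇒≤ c<j+k) (ℕₚ.+-monoˡ-≤ k j≤x)))

  -- The ball of radius `k` in the pairing lies in the ball of radius `w` in `δ`, which lies in that
  -- of the merged division.
  agree⇒twins : ∀ {x i j} → InPair x i → InPair x j → Agree k M paired (toℕ x) i j →
    Twins w M (contract (double x) ∘ δ) i j
  agree⇒twins {x} {i} {j} i∈ j∈ agree = trans i∈ (sym j∈) , λ c far →
    agree c λ (p , q) → far (contract-near (double x)
      ( pair-nonexpansive Q k (δ≤ i) (subst (λ u → u ≤ℕ paired c + k) (sym (inPair⇒paired i∈)) p)
      , pair-nonexpansive Q k (δ≤ c) (subst (λ u → paired c ≤ℕ u + k) (sym (inPair⇒paired i∈)) q)))

  contract-division : ∀ x →
    (∃[ xs ] (length xs ≤ℕ k ×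
      (∀ i → InPair x i → Any (λ j → InPair x j × Agree k M paired (toℕ x) i j) xs))) →
    ThinDivision w (suc k) M q (contract (double x) ∘ δ)
  contract-division x (xs , len , cover) = record
    { mono    = λ i j i≤j → contract-mono y (mono i j i≤j)
    ; bounded = λ i → ℕₚ.≤-trans (contract-mono y (bounded i))
                        (ℕₚ.≤-reflexive (contract-above (double≤q x)))
    ; onto    = new-onto
    ; thin    = new-thin
    }
    where
    y = double x
    new-onto : ∀ l → l ≤ℕ q → ∃[ i ] (contract y (δ i) ≡ l)
    new-onto l l≤q with ℕₚ.≤-total l y
    ... | inj₁ l≤y with i , refl ← onto l (ℕₚ.m≤n⇒m≤1+n l≤q) = i , contract-below l≤y
    ... | inj₂ y≤l with i , δi≡ ← onto (suc l) (s≤s l≤q) =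
      i , trans (cong (contract y) δi≡) (contract-above y≤l)
    new-thin : Thin (suc k) (Twins w M (contract y ∘ δ)) (contract y ∘ δ)
    -- Only the merged part needs new representatives; the others keep theirs, since twins remain
    -- twins.
    new-thin l with ℕₚ.<-cmp l y
    ... | tri≈ _ refl _ = xs , ℕₚ.m≤n⇒m≤1+n len , λ i i∈ →
      Any.map (λ (j∈ , agree) → agree⇒twins i∈ j∈ agree) (cover i i∈)
    ... | tri< l<y _ _ with ys , len′ , cover′ ← thin l = ys , len′ , λ i eq →
      Any.map (twins-contract y) (cover′ i (below i eq (contract-fibre y (δ i))))
      where
      below : ∀ i → contract y (δ i) ≡ l → _ → δ i ≡ l
      below i eq (inj₁ (δi≡ , _)) = trans δi≡ eq
      below i eq (inj₂ (_ , y≤)) = contradiction (subst (y ≤ℕ_) eq y≤) (ℕₚ.<⇒≱ l<y)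
    ... | tri> _ _ y<l with ys , len′ , cover′ ← thin (suc l) = ys , len′ , λ i eq →
      Any.map (twins-contract y) (cover′ i (above i eq (contract-fibre y (δ i))))
      where
      above : ∀ i → contract y (δ i) ≡ l → _ → δ i ≡ suc l
      above i eq (inj₁ (δi≡ , δi≤y)) =
        contradiction (subst (_≤ℕ y) (trans δi≡ eq) δi≤y) (ℕₚ.<⇒≱ y<l)
      above i eq (inj₂ (δi≡ , _)) = trans δi≡ (cong suc eq)

  -- Halving the division would make it k-wide unless some pair of
  -- consecutive parts can be merged while staying thin.
  coarsen : ¬ HasKWideDivision k M → ∃[ y ] ThinDivision w (suc k) M q (contract y ∘ δ)
  coarsen ¬wide with ∀⊎∃ {P = Distinct} (λ x → representatives
      (λ i → contract (double x) (δ i) ℕ.≟ double x)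
      (agree? k M paired (toℕ x))
      (λ agree c far → sym (agree c far)) k)
  ... | inj₁ distinct = contradiction
    (suc Q , paired-lab , paired-division , λ x → distinct⇒wide (distinct x)) ¬wide
  ... | inj₂ (x , reps) = double x , contract-division x reps

-- Identifying two labels

module _ {m : ℕ} {a b : Fin (suc m)} (b≢a : b ≢ a) where

  collapse : Fin (suc m) → Fin m
  collapse c with b Finₚ.≟ c
  ... | yes _  = punchOut b≢a
  ... | no b≢c = punchOut b≢c

  collapse-b : collapse b ≡ punchOut b≢a
  collapse-b with b Finₚ.≟ b
  ... | yes _  = refl
  ... | no b≢b = contradiction refl b≢b

  collapse-≢ : ∀ {c} (b≢c : b ≢ c) → collapse c ≡ punchOut b≢c
  collapse-≢ {c} b≢c with b Finₚ.≟ c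
  ... | yes b≡c = contradiction b≡c b≢c
  ... | no _    = Finₚ.punchOut-cong b refl

  Identified : Fin (suc m) → Fin (suc m) → Set
  Identified c d = c ≡ d ⊎ (c ≡ a × d ≡ b) ⊎ (c ≡ b × d ≡ a)

  collapse⇒identified : ∀ c d → collapse c ≡ collapse d → Identified c d
  collapse⇒identified c d eq with b Finₚ.≟ c | b Finₚ.≟ d
  ... | yes refl | yes refl = inj₁ refl
  ... | yes refl | no b≢d   = inj₂ (inj₂ (refl , sym (Finₚ.punchOut-injective b≢a b≢d eq)))
  ... | no b≢c   | yes refl = inj₂ (inj₁ (Finₚ.punchOut-injective b≢c b≢a eq , refl))
  ... | no b≢c   | no b≢d   = inj₁ (Finₚ.punchOut-injective b≢c b≢d eq)

  identified⇒collapse : ∀ c d → Identified c d → collapse c ≡ collapse d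
  identified⇒collapse c d (inj₁ refl) = refl
  identified⇒collapse c d (inj₂ (inj₁ (refl , refl))) = trans (collapse-≢ b≢a) (sym collapse-b)
  identified⇒collapse c d (inj₂ (inj₂ (refl , refl))) = trans collapse-b (sym (collapse-≢ b≢a))

  collapse-onto : ∀ {N} {lab : Fin N → Fin (suc m)} → Onto lab → Onto (collapse ∘ lab)
  collapse-onto onto c with i , lab-i ← onto (punchIn b c) = i , (begin
    collapse _              ≡⟨ cong collapse lab-i ⟩
    collapse (punchIn b c)  ≡⟨ collapse-≢ b≢ ⟩
    punchOut b≢             ≡⟨ Finₚ.punchOut-punchIn b ⟩
    c                       ∎)
    where
    open ≡-Reasoning
    b≢ : b ≢ punchIn b c
    b≢ = Finₚ.punchInᵢ≢i b c ∘ sym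

  collapse-merge : ∀ {N} (lab : Fin N → Fin (suc m)) → MergeOf lab (collapse ∘ lab)
  collapse-merge lab = a , b , b≢a ∘ sym , λ i j →
    collapse⇒identified (lab i) (lab j) , identified⇒collapse (lab i) (lab j)

-- Sequences of merges down to one part

record Descent {N} (Good : ∀ {m} → (Fin N → Fin (suc m)) → Set)
               {m} (top : Fin N → Fin (suc m)) : Set where
  field
    labs   : ∀ j → Fin N → Fin (suc j)
    start  : labs m ≡ top
    good   : ∀ j → j ≤ℕ m → Good (labs j)
    merges : ∀ j → j <ℕ m → MergeOf (labs (suc j)) (labs j)

module _ {N : ℕ} {Good : ∀ {m} → (Fin N → Fin (suc m)) → Set} where

  stop : {top : Fin N → Fin 1} → Good top → Descent Good top
  stop {top} g = record
    { labs   = λ { zero → top ; (suc j) _ → zero }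
    ; start  = refl
    ; good   = λ { zero z≤n → g }
    ; merges = λ _ ()
    }

  module Extend {m : ℕ} {top : Fin N → Fin (suc (suc m))} {new : Fin N → Fin (suc m)}
    (g : Good top) (mrg : MergeOf top new) (D : Descent Good new) where

    open Descent D

    -- The test is an argument so that the proofs below can split on it, which also gives `top` its
    -- type at level `j`.
    override : ∀ j → Dec (j ≡ suc m) → Fin N → Fin (suc j)
    override j (yes refl) = top
    override j (no _)     = labs j

    extend : Descent Good top
    extend = record
      { labs   = λ j → override j (j ℕ.≟ suc m)
      ; start  = at-top (suc m ℕ.≟ suc m)
      ; good   = λ j j≤ → good′ j j≤ (j ℕ.≟ suc m)
      ; merges = λ j j< → merges′ j j< (suc j ℕ.≟ suc m) (j ℕ.≟ suc m)
      }
      where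
      at-top : ∀ eq? → override (suc m) eq? ≡ top
      at-top (yes eq) rewrite ℕₚ.≡-irrelevant eq refl = refl
      at-top (no neq) = contradiction refl neq
      good′ : ∀ j → j ≤ℕ suc m → ∀ eq? → Good (override j eq?)
      good′ j j≤ (yes refl) = g
      good′ j j≤ (no neq)   = good j (s≤s⁻¹ (ℕₚ.≤∧≢⇒< j≤ neq))
      merges′ : ∀ j → j <ℕ suc m → ∀ eq? eq?′ → MergeOf (override (suc j) eq?) (override j eq?′)
      merges′ j j< _          (yes refl) = contradiction j< (ℕₚ.<-irrefl refl)
      merges′ j j< (yes refl) (no _)     = subst (MergeOf top) (sym start) mrg
      merges′ j j< (no neq)   (no _)     = merges j (ℕₚ.≤∧≢⇒< (s≤s⁻¹ j<) (neq ∘ cong suc))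

-- Interpolating between twin partitions

-- A ball spans at most `2w + 1` parts, each holding at most `2(k + 1)` labels.
stretch-bound : ℕ → ℕ
stretch-bound k = suc (w + w) * (suc k + suc k)
  where w = suc k + suc k

module Build {n k : ℕ} {M : Matrix (suc n)} (M-sym : IsSymmetric M)
  (¬wide : ¬ HasKWideDivision k M) where

  w = suc k + suc k

  Good : ∀ {m} → (Fin (suc n) → Fin (suc m)) → Set
  Good lab = Onto lab × StretchAtMost (stretch-bound k) M lab

  -- Lexicographic induction on `m` and `q`: merge two labels if they separate twins; otherwise the
  -- labels are the twin classes of `δ`, and the division is coarsened instead.
  descent : ∀ m q {δ} {lab : Fin (suc n) → Fin (suc m)} →
    ThinDivision w (suc k) M q δ → Onto lab →
    (∀ {i j} → lab i ≡ lab j → Twins w M δ i j) →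
    Thin (suc k + suc k) (SameLabel lab) δ → Descent Good lab
  descent zero q D onto refines few =
    stop (onto , Stretch.stretch M-sym (ThinDivision.mono D) onto refines few)
  descent (suc m) q {δ} {lab} D onto refines few
    with Finₚ.any? (λ i → Finₚ.any? (λ j → twins? w M δ i j ×-dec ¬? (lab i Finₚ.≟ lab j)))
  ... | yes (i , j , i~j , lab-i≢lab-j) = Extend.extend
          (onto , Stretch.stretch M-sym (ThinDivision.mono D) onto refines few)
          (collapse-merge lab-i≢lab-j lab)
          (descent m q D (collapse-onto lab-i≢lab-j onto) refines′
            (thin-⊆ (cong (collapse lab-i≢lab-j)) few))
    where
    refines′ : ∀ {r s} → collapse lab-i≢lab-j (lab r) ≡ collapse lab-i≢lab-j (lab s) →
      Twins w M δ r s
    refines′ {r} {s} eq with collapse⇒identified lab-i≢lab-j (lab r) (lab s) eq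
    ... | inj₁ same = refines same
    ... | inj₂ (inj₁ (r~j , s~i)) =
      twins-trans (refines r~j) (twins-trans (twins-sym i~j) (refines (sym s~i)))
    ... | inj₂ (inj₂ (r~i , s~j)) =
      twins-trans (refines r~i) (twins-trans i~j (refines (sym s~j)))
  -- In a division with one part the ball contains every column, so all rows are twins and two
  -- labels would separate some.
  descent (suc m) zero {δ} {lab} D onto refines few | no separated =
    contradiction (trans (sym (proj₂ (onto zero))) (trans same (proj₂ (onto (suc zero))))) λ ()
    where
    δ≡0 : ∀ i → δ i ≡ 0
    δ≡0 i = ℕₚ.n≤0⇒n≡0 (ThinDivision.bounded D i)
    all-twins : ∀ i j → Twins w M δ i j
    all-twins i j = trans (δ≡0 i) (sym (δ≡0 j)) , λ c far →
      contradiction (subst₂ (Near w) (sym (δ≡0 i)) (sym (δ≡0 c)) (z≤n , z≤n)) far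
    same : lab (proj₁ (onto zero)) ≡ lab (proj₁ (onto (suc zero)))
    same = decidable-stable (_ Finₚ.≟ _) λ neq → separated (_ , _ , all-twins _ _ , neq)
  descent (suc m) (suc q) {δ} {lab} D onto refines few | no separated
    with y , D′ ← Coarsen.coarsen M-sym D ¬wide =
    -- Each old part holds at most `k + 1` twin classes, hence labels, and a merge joins two parts:
    -- this gives the bound `2(k + 1)`.
    descent (suc m) q D′ onto (twins-contract y ∘ refines)
      (thin-contract y (thin-⊆ twins⇒same (ThinDivision.thin D)))
    where
    twins⇒same : ∀ {i j} → Twins w M δ i j → lab i ≡ lab j
    twins⇒same {i} {j} i~j = decidable-stable (lab i Finₚ.≟ lab j) λ neq →
      separated (i , j , i~j , neq)

  toℕ-thin : ∀ {K} {R : Fin (suc n) → Fin (suc n) → Set} → (∀ i → R i i) → Thin (suc K) R toℕ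
  toℕ-thin {R = R} R-refl l with l ℕ.<? suc n
  ... | yes l< = fromℕ< l< ∷ [] , s≤s z≤n , λ { i refl →
    here (subst (R i) (sym (Finₚ.fromℕ<-toℕ i l<)) (R-refl i)) }
  ... | no l≮ = [] , z≤n , λ { i refl → contradiction (Finₚ.toℕ<n i) l≮ }

  finest : ThinDivision w (suc k) M n toℕ
  finest = record
    { mono    = λ i j i≤j → i≤j
    ; bounded = λ i → s≤s⁻¹ (Finₚ.toℕ<n i)
    ; onto    = λ l l≤n → fromℕ< (s≤s l≤n) , Finₚ.toℕ-fromℕ< (s≤s l≤n)
    -- A singleton part needs one representative, so the bound is `suc k`, positive even for
    -- `k = 0`.
    ; thin    = toℕ-thin λ i → refl , λ _ _ → refl
    }

  from-singletons : Descent Good (λ i → i)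
  from-singletons = descent n n finest (λ i → i , refl)
    (λ { refl → refl , λ _ _ → refl }) (toℕ-thin λ _ → refl)

  stw : StwAtMost (stretch-bound k) M
  stw = record
    { lab        = labs
    ; surjective = λ m m≤n → proj₁ (good m m≤n)
    ; singletons = λ i j eq → subst (λ lab → lab i ≡ lab j → i ≡ j) (sym start) (λ eq → eq) eq
    ; merges     = merges
    } , λ m m≤n → proj₂ (good m m≤n)
    where
    open Descent from-singletons

theorem3 : ∀ {ℓ : Level} (C : (n : ℕ) → Matrix (suc n) → Set ℓ) →
    (∀ n (M : Matrix (suc n)) → C n M → IsSymmetric M) →
    (∃[ s ] (∀ n (M : Matrix (suc n)) → C n M → StwAtMost s M))
    ⇔ (∃[ k ] (∀ n (M : Matrix (suc n)) → C n M → ¬ HasKWideDivision k M))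
theorem3 C C-sym = mk⇔
  (λ (s , bounded) → 3 + s , λ n M M∈C → no-wide-division M (bounded n M M∈C))
  (λ (k , ¬wide) → stretch-bound k , λ n M M∈C → Build.stw (C-sym n M M∈C) (¬wide n M M∈C))
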